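{- For every integer $n>5$ there are at least seven prime numbers $p$ with $n<p<5n$. -}

module Defs where

{-# OPTIONS --safe #-}
module Submission where

-- If at most six primes lie in (n , M] with M = 4 n + 1, then lcm(1 , … , M) is
-- small: primes below s, where s² > M, contribute prime powers at most M each,
-- larger primes occur once, and the primes up to n multiply to at most 8 ^ n,
-- so the lcm is at most M ^ (s + 6) * 8 ^ n.  On the other hand it is a multiple
-- of (2 m + 1) C(2 m , m) ≥ 4 ^ m for m = 2 n, so it is at least 16 ^ n.  With
-- s = 2 ^ r these bounds clash for n > 4192; smaller n are covered by
-- seven explicit lists of primes.

open import Defs
open import Data.Nat
open import Data.Nat.Properties
open import Data.Nat.Combinatorics
open import Data.Nat.Divisibility
open import Data.Nat.DivMod using (m/n*n≡m)
open import Data.Nat.GCD using (gcd)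
open import Data.Nat.LCM using (lcm; m∣lcm[m,n]; n∣lcm[m,n]; lcm-least; gcd*lcm)
open import Data.Nat.Induction using (<-rec)
open import Data.Nat.Primality
open import Data.Nat.Primality.Factorisation using (factorise; factorisationHasAllPrimeFactors)
open import Data.Nat.ListAction using (product)
open import Data.Nat.ListAction.Properties using (product-++)
open import Data.Nat.Tactic.RingSolver using (solve-∀)
open import Data.List using (List; []; _∷_; _++_; length; applyDownFrom; filter)
open import Data.List.Properties using (filter-++)
open import Data.List.Relation.Unary.All as All using (All; []; _∷_; all?)
import Data.List.Relation.Unary.All.Properties as All
open import Data.List.Relation.Unary.AllPairs using ([]; _∷_)
open import Data.List.Relation.Unary.Unique.Propositional using (Unique)
import Data.List.Relation.Unary.Unique.Propositional.Properties as Unique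
open import Data.List.Relation.Unary.Unique.DecPropositional _≟_ using (unique?)
open import Data.Product using (_×_; _,_; Σ-syntax; ∃-syntax; proj₂)
open import Data.Sum using (_⊎_; inj₁; inj₂; [_,_]′)
open import Function using (_∘_; _$_)
open import Relation.Binary.PropositionalEquality
open import Relation.Nullary using (yes; no; contradiction)
open import Relation.Nullary.Decidable using (True; toWitness; _×-dec_)

-- Binomial coefficients: absorption, upper and lower bounds.

nC0≡1 : ∀ n → n C 0 ≡ 1
nC0≡1 n = trans (nCk≡nC[n∸k] {0} {n} z≤n) (nCn≡1 n)

-- The absorption identity, kept free of division. Induction on `n`: Pascal's rule splits one copy
-- of `c`, the hypothesis applies at both `k` and `suc k`, and Pascal's rule recombines the result
-- one row higher.
[n+1]*nCk≡[k+1]*[n+1]C[k+1] : ∀ n k → suc n * (n C k) ≡ suc k * (suc n C suc k)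
[n+1]*nCk≡[k+1]*[n+1]C[k+1] n zero = begin
  suc n * (n C 0)      ≡⟨ cong (suc n *_) (nC0≡1 n) ⟩
  suc n * 1            ≡⟨ *-identityʳ (suc n) ⟩
  suc n                ≡⟨ nC1≡n (suc n) ⟨
  suc n C 1            ≡⟨ *-identityˡ _ ⟨
  1 * (suc n C 1)      ∎
  where open ≡-Reasoning
[n+1]*nCk≡[k+1]*[n+1]C[k+1] zero (suc k) = begin
  1 * (0 C suc k)                  ≡⟨ cong (1 *_) (k>n⇒nCk≡0 {0} {suc k} z<s) ⟩
  0                                ≡⟨ *-zeroʳ (suc (suc k)) ⟨
  suc (suc k) * 0                  ≡⟨ cong (suc (suc k) *_) (k>n⇒nCk≡0 {1} {suc (suc k)} (s<s z<s)) ⟨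
  suc (suc k) * (1 C suc (suc k))  ∎
  where open ≡-Reasoning
[n+1]*nCk≡[k+1]*[n+1]C[k+1] (suc n) (suc k) = begin
  c + suc n * c
    ≡⟨ cong (λ x → c + suc n * x) (nCk+nC[k+1]≡[n+1]C[k+1] n k) ⟨
  c + suc n * (n C k + n C suc k)
    ≡⟨ cong (c +_) (*-distribˡ-+ (suc n) (n C k) (n C suc k)) ⟩
  c + (suc n * (n C k) + suc n * (n C suc k))
    ≡⟨ cong (c +_) (cong₂ _+_ ([n+1]*nCk≡[k+1]*[n+1]C[k+1] n k) ([n+1]*nCk≡[k+1]*[n+1]C[k+1] n (suc k))) ⟩
  c + (suc k * c + suc (suc k) * (suc n C suc (suc k)))
    ≡⟨ +-assoc c (suc k * c) _ ⟨
  suc (suc k) * c + suc (suc k) * (suc n C suc (suc k))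
    ≡⟨ *-distribˡ-+ (suc (suc k)) c _ ⟨
  suc (suc k) * (c + suc n C suc (suc k))
    ≡⟨ cong (suc (suc k) *_) (nCk+nC[k+1]≡[n+1]C[k+1] (suc n) (suc k)) ⟩
  suc (suc k) * (suc (suc n) C suc (suc k)) ∎
  where
  open ≡-Reasoning
  c = suc n C suc k

nCk≤2^n : ∀ n k → n C k ≤ 2 ^ n
nCk≤2^n n zero = ≤-trans (≤-reflexive (nC0≡1 n)) (m^n>0 2 n)
nCk≤2^n zero (suc k) = ≤-trans (≤-reflexive (k>n⇒nCk≡0 {0} {suc k} z<s)) z≤n
nCk≤2^n (suc n) (suc k) = begin
  suc n C suc k      ≡⟨ nCk+nC[k+1]≡[n+1]C[k+1] n k ⟨
  n C k + n C suc k  ≤⟨ +-mono-≤ (nCk≤2^n n k) (nCk≤2^n n (suc k)) ⟩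
  2 ^ n + 2 ^ n      ≡⟨ cong (2 ^ n +_) (+-identityʳ (2 ^ n)) ⟨
  2 ^ suc n          ∎
  where open ≤-Reasoning

nCk*[k!*[n∸k]!]≡n! : ∀ {n k} → k ≤ n → (n C k) * (k ! * (n ∸ k) !) ≡ n !
nCk*[k!*[n∸k]!]≡n! {n} {k} k≤n = trans
  (cong (_* (k ! * (n ∸ k) !)) (nCk≡n!/k![n-k]! k≤n))
  (m/n*n≡m (k![n∸k]!∣n! k≤n))
  where instance _ = k !* (n ∸ k) !≢0

nCk≢0 : ∀ {n k} → k ≤ n → NonZero (n C k)
nCk≢0 {n} {k} k≤n = m*n≢0⇒m≢0 (n C k)
  {{subst NonZero (sym (nCk*[k!*[n∸k]!]≡n! k≤n)) (n !≢0)}}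

-- Absorption and the symmetry of row 2m + 1 give 4 (2m + 1) C(2m , m) = (2m + 2) C(2m + 2 , m + 1).
-- Raising 2m + 2 to 2m + 3 is the only loss in the induction step.
4^m≤[2m+1]*2mCm : ∀ m → 4 ^ m ≤ suc (m + m) * ((m + m) C m)
4^m≤[2m+1]*2mCm zero = ≤-refl
4^m≤[2m+1]*2mCm (suc m) rewrite +-suc m m = begin
  4 * 4 ^ m                                ≤⟨ *-monoʳ-≤ 4 (4^m≤[2m+1]*2mCm m) ⟩
  4 * (suc (m + m) * ((m + m) C m))        ≡⟨ cong (4 *_) ([n+1]*nCk≡[k+1]*[n+1]C[k+1] (m + m) m) ⟩
  4 * (suc m * e)                          ≡⟨ rearrange m e ⟩
  (2 + (m + m)) * (e + e)                  ≤⟨ *-monoˡ-≤ (e + e) (n≤1+n (2 + (m + m))) ⟩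
  (3 + (m + m)) * (e + e)                  ≡⟨ cong (λ x → (3 + (m + m)) * (x + e)) symmetric ⟨
  (3 + (m + m)) * (suc (m + m) C m + e)    ≡⟨ cong ((3 + (m + m)) *_) (nCk+nC[k+1]≡[n+1]C[k+1] (suc (m + m)) m) ⟩
  (3 + (m + m)) * ((2 + (m + m)) C suc m)  ∎
  where
  open ≤-Reasoning
  e = suc (m + m) C suc m
  rearrange : ∀ m e → 4 * (suc m * e) ≡ (2 + (m + m)) * (e + e)
  rearrange = solve-∀
  symmetric : suc (m + m) C m ≡ e
  symmetric = trans (nCk≡nC[n∸k] (m≤n⇒m≤1+n (m≤m+n m m)))
    (cong (suc (m + m) C_) (m+n∸n≡m (suc m) m))

-- Divisors of common multiples via the Leibniz triangle.

-- If 1/c = 1/a − 1/b, then L/c is an integer as soon as L/a and L/b are.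
reciprocal-∸-∣ : ∀ a b c {l} .{{_ : NonZero a}} .{{_ : NonZero b}} →
                 c * b ≡ a * b + c * a → a ∣ l → b ∣ l → c ∣ l
reciprocal-∸-∣ a b c {l} cb≡ab+ca (divides x l≡xa) (divides y l≡yb) =
  -- The quotient l/c is l/a - l/b. Truncated subtraction is harmless, since multiplication
  -- distributes over `∸` unconditionally; the equation is checked after multiplying by `a * b`.
  divides (x ∸ y) (*-cancelʳ-≡ l ((x ∸ y) * c) (a * b) (sym (begin
    (x ∸ y) * c * (a * b)                  ≡⟨ *-assoc (x ∸ y) c (a * b) ⟩
    (x ∸ y) * (c * (a * b))                ≡⟨ *-distribʳ-∸ (c * (a * b)) x y ⟩
    x * (c * (a * b)) ∸ y * (c * (a * b))  ≡⟨ cong₂ _∸_ (rearrange₁ x a b c) (rearrange₂ y a b c) ⟩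
    x * a * (c * b) ∸ y * b * (c * a)      ≡⟨ cong₂ (λ u v → u * (c * b) ∸ v * (c * a)) l≡xa l≡yb ⟨
    l * (c * b) ∸ l * (c * a)              ≡⟨ *-distribˡ-∸ l (c * b) (c * a) ⟨
    l * (c * b ∸ c * a)                    ≡⟨ cong (λ u → l * (u ∸ c * a)) cb≡ab+ca ⟩
    l * (a * b + c * a ∸ c * a)            ≡⟨ cong (l *_) (m+n∸n≡m (a * b) (c * a)) ⟩
    l * (a * b)                            ∎)))
  where
  open ≡-Reasoning
  instance _ = m*n≢0 a b
  rearrange₁ : ∀ x a b c → x * (c * (a * b)) ≡ x * a * (c * b)
  rearrange₁ = solve-∀
  rearrange₂ : ∀ y a b c → y * (c * (a * b)) ≡ y * b * (c * a)
  rearrange₂ = solve-∀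

-- The entries 1 / ((n + 1) C(n , k)) of Leibniz's harmonic triangle satisfy
-- the difference recurrence of reciprocal-∸-∣.
[n+1]*nCk∣ : ∀ {l m} → (∀ {i} .{{_ : NonZero i}} → i ≤ m → i ∣ l) →
             ∀ k n → k ≤ n → n < m → suc n * (n C k) ∣ l
[n+1]*nCk∣ {l} i∣l zero n _ n<m =
  subst (_∣ l) (sym (trans (cong (suc n *_) (nC0≡1 n)) (*-identityʳ (suc n)))) (i∣l n<m)
[n+1]*nCk∣ i∣l (suc k) (suc n) (s≤s k≤n) n<m = reciprocal-∸-∣
  (suc n * (n C k)) (suc (suc n) * (suc n C k)) (suc (suc n) * (suc n C suc k))
  recurrence
  ([n+1]*nCk∣ i∣l k n k≤n (<-trans (n<1+n n) n<m))
  ([n+1]*nCk∣ i∣l k (suc n) (m≤n⇒m≤1+n k≤n) n<m)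
  where
  open ≡-Reasoning
  instance
    _ = nCk≢0 k≤n
    _ = nCk≢0 (m≤n⇒m≤1+n k≤n)
    _ = m*n≢0 (suc n) (n C k)
    _ = m*n≢0 (suc (suc n)) (suc n C k)
  b = suc n C k
  c = suc n C suc k
  rearrange₁ : ∀ n k c d → suc n * c * (suc k * d) ≡ suc n * (suc k * c) * d
  rearrange₁ = solve-∀
  rearrange₂ : ∀ n a b c → suc (suc n) * a * (b + c) ≡ a * (suc (suc n) * b) + suc (suc n) * c * a
  rearrange₂ = solve-∀
  recurrence : suc (suc n) * c * (suc (suc n) * b) ≡
               suc n * (n C k) * (suc (suc n) * b) + suc (suc n) * c * (suc n * (n C k))
  -- Absorption in row n + 1 brings in C(n + 2 , k + 1), which Pascal's rule splits as `b + c`;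
  -- absorption in row n then replaces `suc k * c` by the entry for (n , k).
  recurrence = begin
    suc (suc n) * c * (suc (suc n) * b)
      ≡⟨ cong (suc (suc n) * c *_) ([n+1]*nCk≡[k+1]*[n+1]C[k+1] (suc n) k) ⟩
    suc (suc n) * c * (suc k * (suc (suc n) C suc k))
      ≡⟨ rearrange₁ (suc n) k c _ ⟩
    suc (suc n) * (suc k * c) * (suc (suc n) C suc k)
      ≡⟨ cong₂ (λ u v → suc (suc n) * u * v) ([n+1]*nCk≡[k+1]*[n+1]C[k+1] n k) (nCk+nC[k+1]≡[n+1]C[k+1] (suc n) k) ⟨
    suc (suc n) * (suc n * (n C k)) * (b + c)
      ≡⟨ rearrange₂ n (suc n * (n C k)) b c ⟩
    suc n * (n C k) * (suc (suc n) * b) + suc (suc n) * c * (suc n * (n C k)) ∎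

-- Prime powers in least common multiples.

prime⇒>1 : ∀ {p} → Prime p → 1 < p
prime⇒>1 pp = nonTrivial⇒n>1 _ {{prime⇒nonTrivial pp}}

extract-power : ∀ {p} → Prime p → ∀ n → .{{NonZero n}} →
                ∃[ k ] ∃[ m ] (n ≡ p ^ k * m × p ∤ m)
extract-power {p} pp = <-rec _ step
  where
  instance _ = prime⇒nonTrivial pp
  step : ∀ n → (∀ {m} → m < n → .{{NonZero m}} → ∃[ k ] ∃[ o ] (m ≡ p ^ k * o × p ∤ o)) →
         .{{NonZero n}} → ∃[ k ] ∃[ o ] (n ≡ p ^ k * o × p ∤ o)
  step n rec with p ∣? n
  ... | no p∤n = 0 , n , sym (*-identityˡ n) , p∤n
  ... | yes p∣n with rec (quotient-< p∣n) {{quotient≢0 p∣n}}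
  ...   | k , o , q≡ , p∤o = suc k , o , (begin
    n                 ≡⟨ m∣n⇒n≡m*quotient p∣n ⟩
    p * quotient p∣n  ≡⟨ cong (p *_) q≡ ⟩
    p * (p ^ k * o)   ≡⟨ *-assoc p (p ^ k) o ⟨
    p ^ suc k * o     ∎) , p∤o
    where open ≡-Reasoning

^-monoʳ-∣ : ∀ m {i j} → i ≤ j → m ^ i ∣ m ^ j
^-monoʳ-∣ m {j = j} z≤n = 1∣ (m ^ j)
^-monoʳ-∣ m (s≤s i≤j) = *-monoʳ-∣ m (^-monoʳ-∣ m i≤j)

-- The exponent of `p` in an lcm is the larger of the two exponents. If both were at most `k`, the
-- lcm would divide `p ^ k * (a * b)` with `a`, `b` the parts prime to `p`, and cancelling `p ^ k`
-- would force `p` to divide one of them.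
prime-power∣lcm : ∀ {p} → Prime p → ∀ k m n .{{_ : NonZero m}} .{{_ : NonZero n}} →
                  p ^ k ∣ lcm m n → p ^ k ∣ m ⊎ p ^ k ∣ n
prime-power∣lcm pp zero m n _ = inj₁ (1∣ m)
prime-power∣lcm {p} pp (suc k) m n p^[1+k]∣lcm
  with extract-power pp m | extract-power pp n
... | i , a , refl , p∤a | j , b , refl , p∤b with i ≤? k | j ≤? k
... | no i≰k | _ = inj₁ (∣m⇒∣m*n a (^-monoʳ-∣ p (≰⇒> i≰k)))
... | yes _ | no j≰k = inj₂ (∣m⇒∣m*n b (^-monoʳ-∣ p (≰⇒> j≰k)))
... | yes i≤k | yes j≤k = contradiction p∣ab [ p∤a , p∤b ]′
  where
  instance
    _ = prime⇒nonZero pp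
    _ = m^n≢0 p k
  lcm∣ : lcm (p ^ i * a) (p ^ j * b) ∣ p ^ k * (a * b)
  lcm∣ = lcm-least (*-pres-∣ (^-monoʳ-∣ p i≤k) (m∣m*n b)) (*-pres-∣ (^-monoʳ-∣ p j≤k) (n∣m*n a))
  p∣ab : p ∣ a ⊎ p ∣ b
  p∣ab = euclidsLemma a b pp (*-cancelˡ-∣ (p ^ k)
    (subst (_∣ p ^ k * (a * b)) (*-comm p (p ^ k)) (∣-trans p^[1+k]∣lcm lcm∣)))

lcmUpTo : ℕ → ℕ
lcmUpTo zero    = 1
lcmUpTo (suc n) = lcm (suc n) (lcmUpTo n)

lcm≢0 : ∀ m n .{{_ : NonZero m}} .{{_ : NonZero n}} → NonZero (lcm m n)
lcm≢0 m n = m*n≢0⇒n≢0 (gcd m n) {{subst NonZero (sym (gcd*lcm m n)) (m*n≢0 m n)}}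

lcmUpTo≢0 : ∀ n → NonZero (lcmUpTo n)
lcmUpTo≢0 zero    = _
lcmUpTo≢0 (suc n) = lcm≢0 (suc n) (lcmUpTo n)
  where instance _ = lcmUpTo≢0 n

∣lcmUpTo : ∀ n {i} .{{_ : NonZero i}} → i ≤ n → i ∣ lcmUpTo n
∣lcmUpTo (suc n) i≤1+n with m≤n⇒m<n∨m≡n i≤1+n
... | inj₁ i<1+n = ∣-trans (∣lcmUpTo n (s≤s⁻¹ i<1+n)) (n∣lcm[m,n] (suc n) (lcmUpTo n))
... | inj₂ refl  = m∣lcm[m,n] (suc n) (lcmUpTo n)
∣lcmUpTo zero {suc _} ()

-- Such a power already divides one of the numbers 1 , ... , n + 1. The successor matters: `p ^ 0`
-- divides `lcmUpTo 0` but exceeds 0.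
prime-power∣lcmUpTo⇒≤ : ∀ {p} → Prime p → ∀ k n → p ^ k ∣ lcmUpTo (suc n) → p ^ k ≤ suc n
prime-power∣lcmUpTo⇒≤ pp k zero = ∣⇒≤
prime-power∣lcmUpTo⇒≤ pp k (suc n) p^k∣
  with prime-power∣lcm pp k (suc (suc n)) (lcmUpTo (suc n)) {{_}} {{lcmUpTo≢0 (suc n)}} p^k∣
... | inj₁ p^k∣2+n = ∣⇒≤ p^k∣2+n
... | inj₂ p^k∣lcm = m≤n⇒m≤1+n (prime-power∣lcmUpTo⇒≤ pp k n p^k∣lcm)

-- Products of primes and the bound 8 ^ n for the primorial.

primesBetween : ℕ → ℕ → List ℕ
primesBetween m d = filter prime? (applyDownFrom (λ i → suc (m + i)) d)

-- Since `primesBetween m d` covers the half-open interval (m , m + d], described by its length, the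
-- primorial is the case m = 0 by computation and adjacent intervals concatenate.
primorial : ℕ → ℕ
primorial n = product (primesBetween 0 n)

primorial-+ : ∀ m d → primorial (m + d) ≡ product (primesBetween m d) * primorial m
primorial-+ m d = begin
  product (filter prime? (applyDownFrom suc (m + d)))
    ≡⟨ cong (product ∘ filter prime?) (applyDownFrom-suc-+ d) ⟩
  product (filter prime? (applyDownFrom (λ i → suc (m + i)) d ++ applyDownFrom suc m))
    ≡⟨ cong product (filter-++ prime? (applyDownFrom (λ i → suc (m + i)) d) _) ⟩
  product (primesBetween m d ++ primesBetween 0 m)
    ≡⟨ product-++ (primesBetween m d) _ ⟩
  product (primesBetween m d) * primorial m ∎
  where
  open ≡-Reasoning
  applyDownFrom-suc-+ : ∀ d → applyDownFrom suc (m + d) ≡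
                        applyDownFrom (λ i → suc (m + i)) d ++ applyDownFrom suc m
  applyDownFrom-suc-+ zero    = cong (applyDownFrom suc) (+-identityʳ m)
  applyDownFrom-suc-+ (suc d) rewrite +-suc m d = cong (suc (m + d) ∷_) (applyDownFrom-suc-+ d)

primesBetween-unique : ∀ m d → Unique (primesBetween m d)
primesBetween-unique m d = Unique.filter⁺ prime?
  (Unique.applyDownFrom⁺₁ _ d λ j<i _ eq → <⇒≢ j<i (sym (+-cancelˡ-≡ m _ _ (suc-injective eq))))

primesBetween-prime : ∀ m d → All Prime (primesBetween m d)
primesBetween-prime m d = All.all-filter prime? (applyDownFrom (λ i → suc (m + i)) d)

primesBetween-bounds : ∀ m d → All (λ p → m < p × p ≤ m + d) (primesBetween m d)
primesBetween-bounds m d = All.filter⁺ prime?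
  (All.applyDownFrom⁺₁ _ d λ {i} i<d → s≤s (m≤m+n m i) , +-monoʳ-< m i<d)

-- Write `n` as `q` times the product of the tail. The head `p` cannot divide that product, for it
-- would then occur in the tail, so by Euclid's lemma it divides `q`.
product-∣ : ∀ {ps n} → Unique ps → All Prime ps → All (_∣ n) ps → product ps ∣ n
product-∣ {n = n} [] [] [] = 1∣ n
product-∣ {p ∷ ps} (p≢ps ∷ ps!) (pp ∷ pps) (p∣n ∷ ps∣n) with product-∣ ps! pps ps∣n
... | divides-refl q with euclidsLemma q (product ps) pp p∣n
...   | inj₁ p∣q  = *-monoˡ-∣ (product ps) p∣q
...   | inj₂ p∣Πps = contradiction refl
        (All.lookup p≢ps (factorisationHasAllPrimeFactors pp p∣Πps pps))

product≤^length : ∀ {ps m} → All (_≤ m) ps → product ps ≤ m ^ length ps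
product≤^length []           = ≤-refl
product≤^length (p≤m ∷ ps≤m) = *-mono-≤ p≤m (product≤^length ps≤m)

∣n!⇒≤ : ∀ {p} → Prime p → ∀ n → p ∣ n ! → p ≤ n
∣n!⇒≤ pp zero p∣1 = contradiction (∣1⇒≡1 p∣1) (≢-sym (<⇒≢ (prime⇒>1 pp)))
∣n!⇒≤ pp (suc n) p∣ with euclidsLemma (suc n) (n !) pp p∣
... | inj₁ p∣1+n = ∣⇒≤ p∣1+n
... | inj₂ p∣n!  = m≤n⇒m≤1+n (∣n!⇒≤ pp n p∣n!)

≤⇒∣! : ∀ {m n} .{{_ : NonZero m}} → m ≤ n → m ∣ n !
≤⇒∣! {suc m} m≤n = ∣-trans (m∣m*n (m !)) (m≤n⇒m!∣n! m≤n)

-- `p` divides n ! = C(n , k) k ! (n - k) ! but is too large to divide either factorial on the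
-- right.
prime∣nCk : ∀ {p n k} → Prime p → k ≤ n → k < p → n ∸ k < p → p ≤ n → p ∣ n C k
prime∣nCk {p} {n} {k} pp k≤n k<p n∸k<p p≤n
  with euclidsLemma (n C k) _ pp (subst (p ∣_) (sym (nCk*[k!*[n∸k]!]≡n! k≤n)) (≤⇒∣! {{prime⇒nonZero pp}} p≤n))
... | inj₁ p∣nCk = p∣nCk
... | inj₂ p∣k!*[n∸k]! with euclidsLemma (k !) _ pp p∣k!*[n∸k]!
...   | inj₁ p∣k!     = contradiction (∣n!⇒≤ pp k p∣k!) (<⇒≱ k<p)
...   | inj₂ p∣[n∸k]! = contradiction (∣n!⇒≤ pp _ p∣[n∸k]!) (<⇒≱ n∸k<p)

-- All primes in (m , m + d] divide C(m + d , d), because d ≤ m puts them above both m and d. So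
-- does their product, and the coefficient is at most 2 ^ (m + d).
primorial-step : ∀ m d → d ≤ m → primorial (m + d) ≤ 2 ^ (m + d) * primorial m
primorial-step m d d≤m = begin
  primorial (m + d)                          ≡⟨ primorial-+ m d ⟩
  product (primesBetween m d) * primorial m  ≤⟨ *-monoˡ-≤ (primorial m) (≤-trans (∣⇒≤ Π∣) (nCk≤2^n (m + d) d)) ⟩
  2 ^ (m + d) * primorial m                  ∎
  where
  open ≤-Reasoning
  instance _ = nCk≢0 (m≤n+m d m)
  Π∣ : product (primesBetween m d) ∣ (m + d) C d
  Π∣ = product-∣ (primesBetween-unique m d) (primesBetween-prime m d)
    (All.zipWith (λ (pp , m<p , p≤m+d) → prime∣nCk pp (m≤n+m d m) (≤-<-trans d≤m m<p)
        (subst (_< _) (sym (m+n∸n≡m m d)) m<p) p≤m+d)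
      (primesBetween-prime m d , primesBetween-bounds m d))

-- Strong induction by halving: with n = m + d, m = ⌈n/2⌉ and d = ⌊n/2⌋, the exponent m + d + 3m is
-- at most 3 (m + d) exactly when m ≤ 2d, which holds from n = 2 on. A factor 2 in place of 3 would
-- need m ≤ d, which fails for odd n.
primorial≤2^3n : ∀ n → primorial n ≤ 2 ^ (3 * n)
primorial≤2^3n = <-rec _ step
  where
  open ≤-Reasoning
  rearrange₁ : ∀ m d → m + d + 3 * m ≡ d + 3 * m + m
  rearrange₁ = solve-∀
  rearrange₂ : ∀ m d → d + 3 * m + (d + d) ≡ 3 * (m + d)
  rearrange₂ = solve-∀
  halve : ∀ m d → d ≤ m → m ≤ d + d → primorial m ≤ 2 ^ (3 * m) →
          primorial (m + d) ≤ 2 ^ (3 * (m + d))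
  halve m d d≤m m≤2d ih = begin
    primorial (m + d)          ≤⟨ primorial-step m d d≤m ⟩
    2 ^ (m + d) * primorial m  ≤⟨ *-monoʳ-≤ (2 ^ (m + d)) ih ⟩
    2 ^ (m + d) * 2 ^ (3 * m)  ≡⟨ ^-distribˡ-+-* 2 (m + d) (3 * m) ⟨
    2 ^ (m + d + 3 * m)        ≡⟨ cong (2 ^_) (rearrange₁ m d) ⟩
    2 ^ (d + 3 * m + m)        ≤⟨ ^-monoʳ-≤ 2 (+-monoʳ-≤ (d + 3 * m) m≤2d) ⟩
    2 ^ (d + 3 * m + (d + d))  ≡⟨ cong (2 ^_) (rearrange₂ m d) ⟩
    2 ^ (3 * (m + d))          ∎
  step : ∀ n → (∀ {m} → m < n → primorial m ≤ 2 ^ (3 * m)) → primorial n ≤ 2 ^ (3 * n)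
  step 0 _ = ≤-refl
  step 1 _ = s≤s z≤n
  step n@(suc (suc k)) ih =
    subst (λ n → primorial n ≤ 2 ^ (3 * n)) (trans (+-comm ⌈ n /2⌉ ⌊ n /2⌋) (⌊n/2⌋+⌈n/2⌉≡n n))
      (halve ⌈ n /2⌉ ⌊ n /2⌋ (⌊n/2⌋≤⌈n/2⌉ n) ⌈n/2⌉≤⌊n/2⌋+⌊n/2⌋ (ih (⌈n/2⌉<n k)))
    where
    ⌈n/2⌉≤⌊n/2⌋+⌊n/2⌋ : ⌈ n /2⌉ ≤ ⌊ n /2⌋ + ⌊ n /2⌋
    ⌈n/2⌉≤⌊n/2⌋+⌊n/2⌋ = begin
      suc ⌈ k /2⌉              ≤⟨ s≤s (⌊n/2⌋-mono (n≤1+n (suc k))) ⟩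
      1 + ⌊ n /2⌋              ≤⟨ +-monoˡ-≤ ⌊ n /2⌋ (s≤s z≤n) ⟩
      ⌊ n /2⌋ + ⌊ n /2⌋        ∎

-- Upper and lower bounds for the lcm of 1 , ... , n.

-- Strip off the powers of the largest prime b: they contribute at most m if b ≤ s,
-- and at most b otherwise, since then b ^ 2 > m.
prime-power-bound⇒≤ : ∀ {m s} .{{_ : NonZero m}} → m < s * s → ∀ b n .{{_ : NonZero n}} →
  (∀ {p} → Prime p → p ∣ n → p ≤ b) → (∀ {p} → Prime p → ∀ k → p ^ k ∣ n → p ^ k ≤ m) →
  n ≤ m ^ (b ⊓ s) * primorial b
prime-power-bound⇒≤ {m} {s} m<s² zero n p≤0 _ with factorise n
... | record { factors = [] ; isFactorisation = refl } = ≤-refl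
... | record { factors = p ∷ ps ; isFactorisation = refl ; factorsPrime = pp ∷ _ } =
  contradiction (p≤0 pp (m∣m*n (product ps))) (<⇒≱ (<-trans z<s (prime⇒>1 pp)))
prime-power-bound⇒≤ {m} {s} m<s² (suc b) n p≤1+b p^k≤m with prime? (suc b)
... | no ¬q = begin
    n                                   ≤⟨ prime-power-bound⇒≤ m<s² b n p≤b p^k≤m ⟩
    m ^ (b ⊓ s) * primorial b           ≤⟨ *-monoˡ-≤ (primorial b) (^-monoʳ-≤ m (⊓-monoˡ-≤ s (n≤1+n b))) ⟩
    m ^ (suc b ⊓ s) * primorial b       ∎
  where
  open ≤-Reasoning
  p≤b : ∀ {p} → Prime p → p ∣ n → p ≤ b
  p≤b pp p∣n with m≤n⇒m<n∨m≡n (p≤1+b pp p∣n)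
  ... | inj₁ p<1+b = s≤s⁻¹ p<1+b
  ... | inj₂ refl  = contradiction pp ¬q
... | yes q with extract-power q n
...   | k , o , refl , q∤o = begin
    suc b ^ k * o                                    ≤⟨ *-monoʳ-≤ (suc b ^ k) o≤ ⟩
    suc b ^ k * (m ^ (b ⊓ s) * primorial b)          ≡⟨ *-assoc (suc b ^ k) _ _ ⟨
    suc b ^ k * m ^ (b ⊓ s) * primorial b            ≤⟨ *-monoˡ-≤ (primorial b) absorb ⟩
    m ^ (suc b ⊓ s) * suc b * primorial b            ≡⟨ *-assoc (m ^ (suc b ⊓ s)) _ _ ⟩
    m ^ (suc b ⊓ s) * (suc b * primorial b)          ∎
  where
  open ≤-Reasoning
  instance _ = m*n≢0⇒n≢0 (suc b ^ k) {o}
  p≤b : ∀ {p} → Prime p → p ∣ o → p ≤ b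
  p≤b pp p∣o with m≤n⇒m<n∨m≡n (p≤1+b pp (∣n⇒∣m*n (suc b ^ k) p∣o))
  ... | inj₁ p<1+b = s≤s⁻¹ p<1+b
  ... | inj₂ refl  = contradiction p∣o q∤o
  o≤ : o ≤ m ^ (b ⊓ s) * primorial b
  o≤ = prime-power-bound⇒≤ m<s² b o p≤b (λ pp j p^j∣o → p^k≤m pp j (∣n⇒∣m*n (suc b ^ k) p^j∣o))
  exponent≤1 : s ≤ b → suc b ^ k ≤ suc b
  exponent≤1 s≤b with k ≤? 1
  ... | yes k≤1 = ≤-trans (^-monoʳ-≤ (suc b) k≤1) (≤-reflexive (^-identityʳ (suc b)))
  ... | no  k≰1 = contradiction
    (≤-trans (*-mono-≤ (m≤n⇒m≤1+n s≤b) (m≤n⇒m≤1+n s≤b))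
      (≤-trans (≤-reflexive (cong (suc b *_) (sym (^-identityʳ (suc b)))))
        (p^k≤m q 2 (∣m⇒∣m*n o (^-monoʳ-∣ (suc b) (≰⇒> k≰1))))))
    (<⇒≱ m<s²)
  -- If s ≤ b, the exponent of `m` is already `s` and the prime power is paid for by the new
  -- primorial factor `suc b`. Otherwise the exponent grows by one, which pays for it, and `suc b`
  -- is slack.
  absorb : suc b ^ k * m ^ (b ⊓ s) ≤ m ^ (suc b ⊓ s) * suc b
  absorb with s ≤? b
  ... | yes s≤b = begin
    suc b ^ k * m ^ (b ⊓ s)      ≤⟨ *-mono-≤ (exponent≤1 s≤b) (^-monoʳ-≤ m (⊓-monoˡ-≤ s (n≤1+n b))) ⟩
    suc b * m ^ (suc b ⊓ s)      ≡⟨ *-comm (suc b) _ ⟩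
    m ^ (suc b ⊓ s) * suc b      ∎
  ... | no s≰b = begin
    suc b ^ k * m ^ (b ⊓ s)      ≤⟨ *-monoˡ-≤ (m ^ (b ⊓ s)) (p^k≤m q k (m∣m*n o)) ⟩
    m * m ^ (b ⊓ s)              ≡⟨ cong (λ e → m * m ^ e) (m≤n⇒m⊓n≡m (<⇒≤ (≰⇒> s≰b))) ⟩
    m ^ suc b                    ≡⟨ cong (m ^_) (m≤n⇒m⊓n≡m (≰⇒> s≰b)) ⟨
    m ^ (suc b ⊓ s)              ≤⟨ m≤m*n _ (suc b) ⟩
    m ^ (suc b ⊓ s) * suc b      ∎

lcmUpTo≤ : ∀ {s} n → suc n < s * s → lcmUpTo (suc n) ≤ suc n ^ s * primorial (suc n)
lcmUpTo≤ {s} n 1+n<s² = begin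
  lcmUpTo (suc n)                               ≤⟨ prime-power-bound⇒≤ {s = s} 1+n<s² (suc n) (lcmUpTo (suc n)) p≤1+n p^k≤1+n ⟩
  suc n ^ (suc n ⊓ s) * primorial (suc n)       ≤⟨ *-monoˡ-≤ (primorial (suc n)) (^-monoʳ-≤ (suc n) (m⊓n≤n (suc n) s)) ⟩
  suc n ^ s * primorial (suc n)                 ∎
  where
  open ≤-Reasoning
  instance _ = lcmUpTo≢0 (suc n)
  p^k≤1+n : ∀ {p} → Prime p → ∀ k → p ^ k ∣ lcmUpTo (suc n) → p ^ k ≤ suc n
  p^k≤1+n pp k = prime-power∣lcmUpTo⇒≤ pp k n
  p≤1+n : ∀ {p} → Prime p → p ∣ lcmUpTo (suc n) → p ≤ suc n
  p≤1+n {p} pp p∣ = subst (_≤ suc n) (^-identityʳ p)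
    (p^k≤1+n pp 1 (subst (_∣ lcmUpTo (suc n)) (sym (^-identityʳ p)) p∣))

4^m≤lcmUpTo : ∀ m → 4 ^ m ≤ lcmUpTo (suc (m + m))
4^m≤lcmUpTo m = ≤-trans (4^m≤[2m+1]*2mCm m)
  (∣⇒≤ ([n+1]*nCk∣ (∣lcmUpTo (suc (m + m))) m (m + m) (m≤m+n m m) ≤-refl))
  where instance _ = lcmUpTo≢0 (suc (m + m))

-- Clash of the two bounds for large n.

private
  SevenPrimes : ℕ → Set
  SevenPrimes n = Σ[ ps ∈ List ℕ ] (Unique ps × length ps ≥ 7 × All (λ p → Prime p × n < p × p < 5 * n) ps)

-- With s = 2 ^ r and M < 4 ^ r every term becomes a power of 2, so exponents can be compared and
-- the 3n coming from 8 ^ n cancels. M = 4n + 1 is 2m + 1 for m = 2n, as the lower bound for the lcm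
-- requires.
few-primes⇒n≤ : ∀ n r → suc (4 * n) < 2 ^ (r + r) →
  length (primesBetween n (suc (3 * n))) ≤ 6 → n ≤ (r + r) * (2 ^ r + 6)
few-primes⇒n≤ n r M<4^r ≤6 = +-cancelˡ-≤ (3 * n) n _ (≮⇒≥ λ exp< → <⇒≱ (^-monoʳ-< 2 (s≤s (s≤s z≤n)) exp<) (begin
  2 ^ (3 * n + n)
    ≡⟨ cong (2 ^_) (rearrange₁ n) ⟩
  2 ^ (2 * (n + n))
    ≡⟨ ^-*-assoc 2 2 (n + n) ⟨
  4 ^ (n + n)
    ≤⟨ 4^m≤lcmUpTo (n + n) ⟩
  lcmUpTo (suc (n + n + (n + n)))
    ≡⟨ cong (lcmUpTo ∘ suc) (rearrange₂ n) ⟩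
  lcmUpTo M
    ≤⟨ lcmUpTo≤ {2 ^ r} (4 * n) (subst (M <_) (^-distribˡ-+-* 2 r r) M<4^r) ⟩
  M ^ 2 ^ r * primorial M
    ≡⟨ cong (λ x → M ^ 2 ^ r * primorial x) (rearrange₃ n) ⟩
  M ^ 2 ^ r * primorial (n + suc (3 * n))
    ≡⟨ cong (M ^ 2 ^ r *_) (primorial-+ n (suc (3 * n))) ⟩
  M ^ 2 ^ r * (product ps * primorial n)
    ≤⟨ *-monoʳ-≤ (M ^ 2 ^ r) (*-mono-≤ product≤M^6 (primorial≤2^3n n)) ⟩
  M ^ 2 ^ r * (M ^ 6 * 2 ^ (3 * n))
    ≡⟨ *-assoc (M ^ 2 ^ r) _ _ ⟨
  M ^ 2 ^ r * M ^ 6 * 2 ^ (3 * n)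
    ≡⟨ cong (_* 2 ^ (3 * n)) (^-distribˡ-+-* M (2 ^ r) 6) ⟨
  M ^ (2 ^ r + 6) * 2 ^ (3 * n)
    ≤⟨ *-monoˡ-≤ (2 ^ (3 * n)) (^-monoˡ-≤ (2 ^ r + 6) (<⇒≤ M<4^r)) ⟩
  (2 ^ (r + r)) ^ (2 ^ r + 6) * 2 ^ (3 * n)
    ≡⟨ cong (_* 2 ^ (3 * n)) (^-*-assoc 2 (r + r) (2 ^ r + 6)) ⟩
  2 ^ ((r + r) * (2 ^ r + 6)) * 2 ^ (3 * n)
    ≡⟨ *-comm (2 ^ ((r + r) * (2 ^ r + 6))) _ ⟩
  2 ^ (3 * n) * 2 ^ ((r + r) * (2 ^ r + 6))
    ≡⟨ ^-distribˡ-+-* 2 (3 * n) _ ⟨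
  2 ^ (3 * n + (r + r) * (2 ^ r + 6)) ∎))
  where
  open ≤-Reasoning
  M = suc (4 * n)
  ps = primesBetween n (suc (3 * n))
  rearrange₁ : ∀ n → 3 * n + n ≡ 2 * (n + n)
  rearrange₁ = solve-∀
  rearrange₂ : ∀ n → n + n + (n + n) ≡ 4 * n
  rearrange₂ = solve-∀
  rearrange₃ : ∀ n → suc (4 * n) ≡ n + suc (3 * n)
  rearrange₃ = solve-∀
  product≤M^6 : product ps ≤ M ^ 6
  product≤M^6 = begin
    product ps
      ≤⟨ product≤^length (All.map proj₂ (primesBetween-bounds n (suc (3 * n)))) ⟩
    (n + suc (3 * n)) ^ length ps
      ≡⟨ cong (_^ length ps) (rearrange₃ n) ⟨
    M ^ length ps
      ≤⟨ ^-monoʳ-≤ M ≤6 ⟩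
    M ^ 6 ∎

-- Keeps the search for `r` going: when 4 ^ r is still at most 4n + 1, it shows that `suc r` also
-- satisfies the lower condition on n. The inequality first holds at r = 8.
4[r+1][2^[r+1]+6]<4^r : ∀ {r} → 8 ≤′ r → suc (4 * ((suc r + suc r) * (2 ^ suc r + 6))) < 2 ^ (r + r)
4[r+1][2^[r+1]+6]<4^r {r} 8≤r = <-≤-trans (square 8≤r) (≤-reflexive (sym (^-distribˡ-+-* 2 r r)))
  where
  open ≤-Reasoning
  rearrange₁ : ∀ r x → suc (4 * ((suc (suc r) + suc (suc r)) * (2 * (2 * x) + 6))) + (32 * (r * x) + 144 * r + 99)
                       ≡ 4 * suc (4 * ((suc r + suc r) * (2 * x + 6)))
  rearrange₁ = solve-∀
  rearrange₂ : ∀ x → 4 * (x * x) ≡ 2 * x * (2 * x)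
  rearrange₂ = solve-∀
  square : ∀ {r} → 8 ≤′ r → suc (4 * ((suc r + suc r) * (2 ^ suc r + 6))) < 2 ^ r * 2 ^ r
  square ≤′-refl = ≤ᵇ⇒≤ 37298 65536 _
  -- The right side exactly quadruples from `r` to `suc r`. The left side grows by less: the added
  -- term is four times its old value minus its new one.
  square {suc r} (≤′-step 8≤r) = begin-strict
    suc (4 * ((suc (suc r) + suc (suc r)) * (2 * (2 * x) + 6)))  ≤⟨ m≤m+n _ (32 * (r * x) + 144 * r + 99) ⟩
    suc (4 * ((suc (suc r) + suc (suc r)) * (2 * (2 * x) + 6))) + (32 * (r * x) + 144 * r + 99)
                                                                 ≡⟨ rearrange₁ r x ⟩
    4 * suc (4 * ((suc r + suc r) * (2 * x + 6)))                <⟨ *-monoʳ-< 4 (square 8≤r) ⟩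
    4 * (x * x)                                                  ≡⟨ rearrange₂ x ⟩
    2 * x * (2 * x)                                              ∎
    where x = 2 ^ r

n<2^n : ∀ n → n < 2 ^ n
n<2^n zero    = z<s
n<2^n (suc n) = begin-strict
  suc n            <⟨ s<s (n<2^n n) ⟩
  1 + 2 ^ n        ≤⟨ +-monoˡ-≤ (2 ^ n) (m^n>0 2 n) ⟩
  2 ^ n + 2 ^ n    ≡⟨ cong (2 ^ n +_) (+-identityʳ (2 ^ n)) ⟨
  2 ^ suc n        ∎
  where open ≤-Reasoning

-- Take the least r ≥ 8 with 4 n + 1 < 4 ^ r: minimality bounds n from below by about 4 ^ (r - 2).
∃-exponent : ∀ n → 4193 ≤ n → ∃[ r ] (suc (4 * n) < 2 ^ (r + r) × (r + r) * (2 ^ r + 6) < n)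
-- At r = 8 the lower condition evaluates to 4192 < n, which is the hypothesis. The upper condition
-- certainly holds at r = n + 8, so `n` steps of fuel suffice.
∃-exponent n 4193≤n = search n ≤′-refl 1+4n<4^[n+8] 4193≤n
  where
  open ≤-Reasoning
  1+4n<4^[n+8] : suc (4 * n) < 2 ^ (n + 8 + (n + 8))
  1+4n<4^[n+8] = begin-strict
    1 + 4 * n              <⟨ +-monoˡ-< (4 * n) {1} {4} (s<s z<s) ⟩
    4 + 4 * n              ≡⟨ *-suc 4 n ⟨
    4 * suc n              ≤⟨ *-monoʳ-≤ 4 (n<2^n n) ⟩
    2 ^ 2 * 2 ^ n          ≡⟨ ^-distribˡ-+-* 2 2 n ⟨
    2 ^ (2 + n)            ≡⟨ cong (2 ^_) (+-comm 2 n) ⟩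
    2 ^ (n + 2)            ≤⟨ ^-monoʳ-≤ 2 (+-monoʳ-≤ n {2} {8} (s≤s (s≤s z≤n))) ⟩
    2 ^ (n + 8)            ≤⟨ ^-monoʳ-≤ 2 (m≤m+n (n + 8) (n + 8)) ⟩
    2 ^ (n + 8 + (n + 8))  ∎
  search : ∀ d {r} → 8 ≤′ r → suc (4 * n) < 2 ^ (d + r + (d + r)) → (r + r) * (2 ^ r + 6) < n →
           ∃[ r ] (suc (4 * n) < 2 ^ (r + r) × (r + r) * (2 ^ r + 6) < n)
  search zero    {r} _   upper lower = r , upper , lower
  search (suc d) {r} 8≤r upper lower with suc (4 * n) <? 2 ^ (r + r)
  ... | yes 1+4n<4^r = r , 1+4n<4^r , lower
  ... | no  1+4n≮4^r = search d (≤′-step 8≤r)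
    (subst (λ e → suc (4 * n) < 2 ^ (e + e)) (sym (+-suc d r)) upper)
    (*-cancelˡ-< 4 _ n (s<s⁻¹ (<-≤-trans (4[r+1][2^[r+1]+6]<4^r 8≤r) (≮⇒≥ 1+4n≮4^r))))

sevenPrimes-large : ∀ n → 4201 ≤ n → SevenPrimes n
sevenPrimes-large n 4201≤n with ∃-exponent n (≤-trans (≤ᵇ⇒≤ 4193 4201 _) 4201≤n) | 7 ≤? length (primesBetween n (suc (3 * n)))
... | r , 1+4n<4^r , f<n | no 7≰ =
  contradiction (few-primes⇒n≤ n r 1+4n<4^r (s≤s⁻¹ (≰⇒> 7≰))) (<⇒≱ f<n)
... | _ | yes 7≤ = primesBetween n (suc (3 * n)) , primesBetween-unique n _ , 7≤ ,
  All.zipWith (λ (pp , n<p , p≤) → pp , n<p , ≤-<-trans p≤ n+suc[3n]<5n)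
    (primesBetween-prime n _ , primesBetween-bounds n _)
  where
  open ≤-Reasoning
  rearrange₁ : ∀ n → n + suc (3 * n) ≡ 1 + 4 * n
  rearrange₁ = solve-∀
  n+suc[3n]<5n : n + suc (3 * n) < 5 * n
  n+suc[3n]<5n = begin-strict
    n + suc (3 * n)  ≡⟨ rearrange₁ n ⟩
    1 + 4 * n        <⟨ +-monoˡ-< (4 * n) {1} {n} (≤-trans (≤ᵇ⇒≤ 2 4201 _) 4201≤n) ⟩
    5 * n            ∎

-- Small n by explicit lists of primes.

window : ∀ a b ps →
  {True (unique? ps ×-dec 7 ≤? length ps ×-dec all? (λ p → prime? p ×-dec b ≤? p ×-dec p <? 5 * a) ps)} →
  -- One list serves every n with a ≤ n < b, since its entries are at least b and below 5a; larger n
  -- are passed on to `above`. The conditions on the list are decided by evaluation.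
  ∀ {n} → (b ≤ n → SevenPrimes n) → a ≤ n → SevenPrimes n
window a b ps {checked} {n} above a≤n with n <? b | toWitness checked
... | no n≮b  | _ = above (≮⇒≥ n≮b)
... | yes n<b | ps! , 7≤ , bounds = ps , ps! , 7≤ ,
  All.map (λ (pp , b≤p , p<5a) → pp , <-≤-trans n<b b≤p , <-≤-trans p<5a (*-monoʳ-≤ 5 a≤n)) bounds

theorem3p1p2 : ∀ (n : ℕ) → n > 5 →
    Σ[ ps ∈ List ℕ ] (Unique ps × length ps ≥ 7 × All (λ p → Prime p × n < p × p < 5 * n) ps)
theorem3p1p2 n =
  -- Each list but the last consists of the seven largest primes below 5a; its least entry is b and
  -- starts the next window. The last list starts at 4201, the first prime beyond 4192, where the
  -- general argument takes over.
  window 6 7 (7 ∷ 11 ∷ 13 ∷ 17 ∷ 19 ∷ 23 ∷ 29 ∷ []) $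
  window 7 11 (11 ∷ 13 ∷ 17 ∷ 19 ∷ 23 ∷ 29 ∷ 31 ∷ []) $
  window 11 29 (29 ∷ 31 ∷ 37 ∷ 41 ∷ 43 ∷ 47 ∷ 53 ∷ []) $
  window 29 107 (107 ∷ 109 ∷ 113 ∷ 127 ∷ 131 ∷ 137 ∷ 139 ∷ []) $
  window 107 487 (487 ∷ 491 ∷ 499 ∷ 503 ∷ 509 ∷ 521 ∷ 523 ∷ []) $
  window 487 2383 (2383 ∷ 2389 ∷ 2393 ∷ 2399 ∷ 2411 ∷ 2417 ∷ 2423 ∷ []) $
  window 2383 4201 (4201 ∷ 4211 ∷ 4217 ∷ 4219 ∷ 4229 ∷ 4231 ∷ 4241 ∷ []) $
  sevenPrimes-large n
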